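{- Let $c\geq 3$. Then for every positive integer $n$, $\mathcal{G}_{\{1,2c\}}(n)=\mathcal{G}_{\{1,6\}}(\phi_1(n))$.
   Context: For a set $\mathcal{C}$ of positive integers, $\mathcal{G}_{\mathcal{C}}$ is defined recursively by $\mathcal{G}_{\mathcal{C}}(n)=\operatorname{mex}\{\mathcal{G}_{\mathcal{C}}(h_0)\oplus\cdots\oplus\mathcal{G}_{\mathcal{C}}(h_d): d\in\mathcal{C}, h_i\geq 1 \text{ integers}, \sum h_i=n\}$, with $\oplus$ bitwise XOR and mex the least nonnegative integer not in the set (the nim-sequence of the game \textsc{cut} with cut-set $\mathcal{C}$). For $c\geq 3$ and $1\le r\le 2c$, define $r'=1$ if $r=1$; $r'=2$ if $r=2$; $r'=3$ if $2<r<2c-1$ and $r$ odd; $r'=4$ if $2<r<2c-1$ and $r$ even; $r'=5$ if $r=2c-1$; $r'=6$ if $r=2c$. For $p\geq 1$ and $n\geq p$, write uniquely $n=2cq+r+p-1$ with $q\geq 0$, $1\le r\le 2c$, and set $\phi_p(n)=6q+r'+p-1$. In particular $\phi_1(2cq+r)=6q+r'$. -}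

module Defs where

open import Data.Nat using (ℕ; zero; suc; _+_; _*_; _∸_; _≡ᵇ_; _<ᵇ_; NonZero)
open import Data.Nat.DivMod using (_/_; _%_)
open import Data.Bool using (Bool; true; false; if_then_else_)
open import Data.List using (List; []; _∷_; map; concatMap; upTo; length)
open import Data.Bool.ListAction using (any)
open import Data.Nat.Properties using (m*n≢0)

-- Bitwise XOR on ℕ (nim-sum).
-- xorFuel k m n processes the k lowest binary digits; k = m + n suffices
-- since both m and n have at most m + n binary digits.

xorFuel : ℕ → ℕ → ℕ → ℕ
xorFuel zero    m n = 0
xorFuel (suc k) m n =
  (if (m % 2) ≡ᵇ (n % 2) then 0 else 1) + 2 * xorFuel k (m / 2) (n / 2)

_⊕_ : ℕ → ℕ → ℕ
m ⊕ n = xorFuel (m + n) m n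

infixl 6 _⊕_

-- mex of a finite list: least natural number not occurring in the list.
-- (The mex is at most the length of the list, so that much fuel suffices.)

elemᵇ : ℕ → List ℕ → Bool
elemᵇ m xs = any (λ x → x ≡ᵇ m) xs

mexAux : ℕ → ℕ → List ℕ → ℕ
mexAux zero     m xs = m
mexAux (suc k)  m xs = if elemᵇ m xs then mexAux k (suc m) xs else m

mex : List ℕ → ℕ
mex xs = mexAux (length xs) 0 xs

partXors : (ℕ → ℕ) → ℕ → ℕ → List ℕ
partXors f zero    m = if m ≡ᵇ 0 then (0 ∷ []) else []
partXors f (suc k) m =
  concatMap (λ h → map (λ x → f (suc h) ⊕ x) (partXors f k (m ∸ suc h))) (upTo m)

options : List ℕ → (ℕ → ℕ) → ℕ → List ℕ
options C f n = concatMap (λ d → partXors f (suc d) n) C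

-- nimUpTo C n agrees with the nim-sequence 𝒢_C on 1, …, n-1
-- (for a cut-set C of positive integers, all parts hᵢ are < n whenever d ≥ 1,
-- so only already-computed values are consulted).  The value at 0 is an
-- unused dummy 0.
nimUpTo : List ℕ → ℕ → (ℕ → ℕ)
nimUpTo C zero    = λ _ → 0
nimUpTo C (suc n) = λ m → if m <ᵇ n then f m else mex (options C f n)
  where
  f : ℕ → ℕ
  f = nimUpTo C n

𝒢 : List ℕ → ℕ → ℕ
𝒢 C n = nimUpTo C (suc n) n

even? : ℕ → Bool
even? r = (r % 2) ≡ᵇ 0

rPrime : ℕ → ℕ → ℕ
rPrime c r =
  if r ≡ᵇ 1 then 1 else
  if r ≡ᵇ 2 then 2 else
  if r ≡ᵇ (2 * c ∸ 1) then 5 else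
  if r ≡ᵇ (2 * c) then 6 else
  if even? r then 4 else 3

-- φ_p(n) for n ≥ p: write n = 2cq + r + p - 1 with q ≥ 0, 1 ≤ r ≤ 2c,
-- i.e. n - p = 2cq + (r - 1) with 0 ≤ r - 1 < 2c; then φ_p(n) = 6q + r' + p - 1.
φ : (c : ℕ) → .{{NonZero c}} → ℕ → ℕ → ℕ
φ c p n = 6 * q + rPrime c r + p ∸ 1
  where
  instance
    2c≢0 : NonZero (2 * c)
    2c≢0 = m*n≢0 2 c
  m = n ∸ p
  q = m / (2 * c)
  r = suc (m % (2 * c))

{-# OPTIONS --safe #-}

-- Put M = 2c and write n = suc a with a = M (6 Q + s) + j, s < 6, j < M. The nim-value of n is 8 Q + g s j, where
-- g s j depends only on s, on the parity of j and on whether j = 0; comparing this for M and for 6 gives the theorem.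
-- A cut into M + 1 parts suc aᵢ has Σ aᵢ = a - M. The weight of (parity of Σ aᵢ, XOR of the values) is subadditive and
-- the weight of a single part suc a is a / M = 6 Q + s, so such a cut never has the value of n. For two parts,
-- Q₀ ⊕ Q₁ = Q and Q₀ + Q₁ ≤ Q leave finitely many cases. Conversely each smaller value v has at most two
-- parts of total weight below a / M that produce v up to a last bit; the rest of the pile is split evenly and sets that
-- bit. The few remaining v, in the same period as n, come from two parts.
module Submission where

open import Defs
open import Data.Nat hiding (parity)
open import Data.Nat.Properties
open import Data.Nat.DivMod
open import Data.Nat.Divisibility using (_∣_; m∣m*n; n∣m*n; ∣m⇒∣m*n; ∣-refl; n∣m⇒m%n≡0)
open import Data.Nat.Tactic.RingSolver using (solve-∀)
open import Data.Bool using (T; true; false; if_then_else_)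
open import Data.Fin using (Fin)
open import Data.Fin.Properties using (injective⇒≤; toℕ<n; toℕ-injective)
open import Data.List using (List; []; _∷_; map; length; lookup)
open import Data.List.Membership.Propositional using (_∈_; _∉_; find)
open import Data.List.Membership.Propositional.Properties
  using (∈-map⁺; ∈-map⁻; ∈-concatMap⁺; ∈-concatMap⁻; ∈-upTo⁺; ∈-upTo⁻)
import Data.List.Relation.Unary.Any as Any
open Any using (here; there; index)
open import Data.List.Relation.Unary.Any.Properties using (lookup-index)
open import Data.Product using (_×_; _,_; proj₁; proj₂; ∃-syntax)
open import Data.Sum using (_⊎_; inj₁; inj₂)
open import Relation.Binary.Definitions using (tri<; tri≈; tri>)
open import Relation.Binary.PropositionalEquality hiding (J)
open import Relation.Nullary using (¬_; Dec; yes; no; contradiction)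
open import Relation.Nullary.Decidable using (from-yes; ¬?; _×-dec_; _→-dec_; _⊎-dec_)

-- Bitwise XOR

bit : ℕ → ℕ → ℕ
bit x y = if x ≡ᵇ y then 0 else 1

half≤ : ∀ {m k} → m ≤ suc k → m / 2 ≤ k
half≤ {zero} _ = z≤n
half≤ {suc m} (s≤s m≤k) = ≤-trans (≤-pred (m/n<m (suc m) 2 (s≤s (s≤s z≤n)))) m≤k

xorFuel-0-0 : ∀ k → xorFuel k 0 0 ≡ 0
xorFuel-0-0 zero = refl
xorFuel-0-0 (suc k) rewrite xorFuel-0-0 k = refl

-- Both arguments are halved while the fuel drops by one, so any common bound on them is enough
-- fuel: when it runs out, both are 0.
xorFuel-irrelevant : ∀ k l {m n} → m ≤ k → n ≤ k → m ≤ l → n ≤ l → xorFuel k m n ≡ xorFuel l m n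
xorFuel-irrelevant zero l z≤n z≤n _ _ = sym (xorFuel-0-0 l)
xorFuel-irrelevant (suc k) zero _ _ z≤n z≤n = xorFuel-0-0 (suc k)
xorFuel-irrelevant (suc k) (suc l) {m} {n} a b c d =
  cong (λ z → bit (m % 2) (n % 2) + 2 * z)
    (xorFuel-irrelevant k l (half≤ a) (half≤ b) (half≤ c) (half≤ d))

-- The two sides run on different fuel, so this recursion is not definitional.
⊕-step : ∀ m n → m ⊕ n ≡ bit (m % 2) (n % 2) + 2 * ((m / 2) ⊕ (n / 2))
⊕-step m n = trans
  (xorFuel-irrelevant (m + n) (suc (m + n)) m≤ n≤ (m≤n⇒m≤1+n m≤) (m≤n⇒m≤1+n n≤))
  (cong (λ z → bit (m % 2) (n % 2) + 2 * z)
    (xorFuel-irrelevant (m + n) (m / 2 + n / 2)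
      (≤-trans (m/n≤m m 2) m≤) (≤-trans (m/n≤m n 2) n≤) (m≤m+n _ _) (m≤n+m _ _)))
  where
  m≤ : m ≤ m + n
  m≤ = m≤m+n m n
  n≤ : n ≤ m + n
  n≤ = m≤n+m n m

bit≤+ : ∀ x y → bit x y ≤ x + y
bit≤+ zero zero = z≤n
bit≤+ zero (suc y) = s≤s z≤n
bit≤+ (suc x) y with suc x ≡ᵇ y
... | true = z≤n
... | false = s≤s z≤n

bit-self : ∀ x → bit x x ≡ 0
bit-self zero = refl
bit-self (suc x) = bit-self x

bit-0 : ∀ x → x < 2 → bit x 0 ≡ x
bit-0 zero _ = refl
bit-0 (suc zero) _ = refl
bit-0 (suc (suc x)) (s≤s (s≤s ()))

halves : ∀ m → m % 2 + 2 * (m / 2) ≡ m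
halves m = trans (cong (m % 2 +_) (*-comm 2 (m / 2))) (sym (m≡m%n+[m/n]*n m 2))

-- XOR is addition without carries; digit by digit it is at most the sum.
xorFuel≤+ : ∀ k m n → xorFuel k m n ≤ m + n
xorFuel≤+ zero m n = z≤n
xorFuel≤+ (suc k) m n = begin
  bit (m % 2) (n % 2) + 2 * xorFuel k (m / 2) (n / 2)
    ≤⟨ +-mono-≤ (bit≤+ (m % 2) (n % 2)) (*-monoʳ-≤ 2 (xorFuel≤+ k (m / 2) (n / 2))) ⟩
  (m % 2 + n % 2) + 2 * (m / 2 + n / 2)
    ≡⟨ lem (m % 2) (n % 2) (m / 2) (n / 2) ⟩
  (m % 2 + 2 * (m / 2)) + (n % 2 + 2 * (n / 2))
    ≡⟨ cong₂ _+_ (halves m) (halves n) ⟩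
  m + n ∎
  where
  open ≤-Reasoning
  lem : ∀ a b x y → (a + b) + 2 * (x + y) ≡ (a + 2 * x) + (b + 2 * y)
  lem = solve-∀

⊕≤+ : ∀ m n → m ⊕ n ≤ m + n
⊕≤+ m n = xorFuel≤+ (m + n) m n

xorFuel-self : ∀ k m → xorFuel k m m ≡ 0
xorFuel-self zero m = refl
xorFuel-self (suc k) m rewrite bit-self (m % 2) | xorFuel-self k (m / 2) = refl

⊕-self : ∀ m → m ⊕ m ≡ 0
⊕-self m = xorFuel-self (m + m) m

xorFuel-identityʳ : ∀ k m → m ≤ k → xorFuel k m 0 ≡ m
xorFuel-identityʳ zero zero z≤n = refl
xorFuel-identityʳ (suc k) m m≤k = trans
  (cong₂ (λ x y → x + 2 * y) (bit-0 (m % 2) (m%n<n m 2)) (xorFuel-identityʳ k (m / 2) (half≤ m≤k)))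
  (halves m)

⊕-identityʳ : ∀ m → m ⊕ 0 ≡ m
⊕-identityʳ m = xorFuel-identityʳ (m + 0) m (m≤m+n m 0)

-- t and u are the k low binary digits of the two summands.
⊕-digits : ∀ k {t u} A B → t < 2 ^ k → u < 2 ^ k →
  (2 ^ k * A + t) ⊕ (2 ^ k * B + u) ≡ 2 ^ k * (A ⊕ B) + (t ⊕ u)
⊕-digits zero {zero} {zero} A B _ _ rewrite +-identityʳ A | +-identityʳ B | +-identityʳ A | +-identityʳ B =
  sym (trans (+-identityʳ _) (+-identityʳ _))
⊕-digits zero {suc t} A B (s≤s ()) _
⊕-digits zero {zero} {suc u} A B _ (s≤s ())
⊕-digits (suc k) {t} {u} A B t< u< = begin
  (2 ^ suc k * A + t) ⊕ (2 ^ suc k * B + u)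
    ≡⟨ cong₂ _⊕_ (cong (_+ t) (*-assoc 2 (2 ^ k) A)) (cong (_+ u) (*-assoc 2 (2 ^ k) B)) ⟩
  (2 * (2 ^ k * A) + t) ⊕ (2 * (2 ^ k * B) + u)
    ≡⟨ ⊕-step (2 * (2 ^ k * A) + t) (2 * (2 ^ k * B) + u) ⟩
  bit ((2 * (2 ^ k * A) + t) % 2) ((2 * (2 ^ k * B) + u) % 2)
    + 2 * (((2 * (2 ^ k * A) + t) / 2) ⊕ ((2 * (2 ^ k * B) + u) / 2))
    ≡⟨ cong₂ (λ x y → x + 2 * y)
         (cong₂ bit (low (2 ^ k * A) t) (low (2 ^ k * B) u))
         (cong₂ _⊕_ (high (2 ^ k * A) t) (high (2 ^ k * B) u)) ⟩
  bit (t % 2) (u % 2) + 2 * ((2 ^ k * A + t / 2) ⊕ (2 ^ k * B + u / 2))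
    ≡⟨ cong (λ z → bit (t % 2) (u % 2) + 2 * z) (⊕-digits k A B (t/2< t t<) (t/2< u u<)) ⟩
  bit (t % 2) (u % 2) + 2 * (2 ^ k * (A ⊕ B) + ((t / 2) ⊕ (u / 2)))
    ≡⟨ lem (bit (t % 2) (u % 2)) (2 ^ k) (A ⊕ B) ((t / 2) ⊕ (u / 2)) ⟩
  2 ^ suc k * (A ⊕ B) + (bit (t % 2) (u % 2) + 2 * ((t / 2) ⊕ (u / 2)))
    ≡⟨ cong (2 ^ suc k * (A ⊕ B) +_) (sym (⊕-step t u)) ⟩
  2 ^ suc k * (A ⊕ B) + (t ⊕ u) ∎
  where
  open ≡-Reasoning
  t/2< : ∀ t → t < 2 ^ suc k → t / 2 < 2 ^ k
  t/2< t t< = m<n*o⇒m/o<n (subst (t <_) (*-comm 2 (2 ^ k)) t<)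
  swap : ∀ a t → 2 * a + t ≡ t + a * 2
  swap = solve-∀
  low : ∀ a t → (2 * a + t) % 2 ≡ t % 2
  low a t = trans (cong (_% 2) (swap a t)) ([m+kn]%n≡m%n t a 2)
  high : ∀ a t → (2 * a + t) / 2 ≡ a + t / 2
  high a t = trans (cong (_/ 2) (swap a t))
    (trans (+-distrib-/-∣ʳ t (n∣m*n a))
      (trans (cong (t / 2 +_) (m*n/n≡m a 2)) (+-comm (t / 2) a)))
  lem : ∀ b p x y → b + 2 * (p * x + y) ≡ (2 * p) * x + (b + 2 * y)
  lem = solve-∀

-- Minimal excludants and cuts

≡ᵇ-refl : ∀ m → (m ≡ᵇ m) ≡ true
≡ᵇ-refl zero = refl
≡ᵇ-refl (suc m) = ≡ᵇ-refl m

elemᵇ-true : ∀ {m} xs → elemᵇ m xs ≡ true → m ∈ xs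
elemᵇ-true {m} (x ∷ xs) e with x ≡ᵇ m in eq
... | true = here (sym (≡ᵇ⇒≡ x m (subst T (sym eq) _)))
... | false = there (elemᵇ-true xs e)

elemᵇ-false : ∀ {m} xs → elemᵇ m xs ≡ false → m ∉ xs
elemᵇ-false {m} (x ∷ xs) e m∈ with x ≡ᵇ m in eq
elemᵇ-false {m} (x ∷ xs) e (here refl) | false = contradiction (trans (sym eq) (≡ᵇ-refl m)) λ ()
elemᵇ-false {m} (x ∷ xs) e (there m∈) | false = elemᵇ-false xs e m∈

-- The invariant `v ≤ m + k` says that the fuel lasts until the search reaches `v`.
mexAux-unique : ∀ k m {v} xs → m ≤ v → v ≤ m + k → v ∉ xs → (∀ {w} → w < v → w ∈ xs) →
  mexAux k m xs ≡ v
mexAux-unique zero m xs m≤v v≤m _ _ = ≤-antisym m≤v (subst (_ ≤_) (+-identityʳ m) v≤m)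
mexAux-unique (suc k) m {v} xs m≤v v≤ v∉ below with elemᵇ m xs in eq
... | true = mexAux-unique k (suc m) xs
        (≤∧≢⇒< m≤v λ { refl → v∉ (elemᵇ-true xs eq) }) (subst (v ≤_) (+-suc m k) v≤) v∉ below
... | false with m ≟ v
...   | yes m≡v = m≡v
...   | no m≢v = contradiction (below (≤∧≢⇒< m≤v m≢v)) (elemᵇ-false xs eq)

-- Pigeonhole: distinct numbers below `v` occur at distinct positions. This makes `length xs` enough
-- fuel for `mex`.
below⇒≤length : ∀ {v} (xs : List ℕ) → (∀ {w} → w < v → w ∈ xs) → v ≤ length xs
below⇒≤length {v} xs below = injective⇒≤ {f = position} position-injective
  where
  position : Fin v → Fin (length xs)
  position i = index (below (toℕ<n i))
  position-injective : ∀ {i j} → position i ≡ position j → i ≡ j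
  position-injective {i} {j} eq = toℕ-injective (trans (lookup-index (below (toℕ<n i)))
    (trans (cong (lookup xs) eq) (sym (lookup-index (below (toℕ<n j))))))

mex-unique : ∀ {v} xs → v ∉ xs → (∀ {w} → w < v → w ∈ xs) → mex xs ≡ v
mex-unique xs v∉ below = mexAux-unique (length xs) 0 xs z≤n (below⇒≤length xs below) v∉ below

-- Each pile size is lowered by one, so the k parts of a pile of size k + a have sizes 1 + h with the h summing to a.
data Cut (f : ℕ → ℕ) : ℕ → ℕ → ℕ → Set where
  []  : Cut f 0 0 0
  _∷_ : ∀ {k a x} h → Cut f k a x → Cut f (suc k) (h + a) (f (suc h) ⊕ x)

infixr 5 _∷_

Cut⇒∈ : ∀ {f k a x} → Cut f k a x → x ∈ partXors f k (k + a)
Cut⇒∈ [] = here refl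
Cut⇒∈ {f} {suc k} (_∷_ {a = a} {x} h p) =
  ∈-concatMap⁺ _ (Any.map (λ { refl → ∈-map⁺ _ tail }) (∈-upTo⁺ (s≤s h≤)))
  where
  h≤ : h ≤ k + (h + a)
  h≤ = ≤-trans (m≤m+n h a) (m≤n+m _ k)
  swap : ∀ k h a → k + (h + a) ≡ h + (k + a)
  swap = solve-∀
  tail : x ∈ partXors f k (k + (h + a) ∸ h)
  tail = subst (λ m → x ∈ partXors f k m)
    (sym (trans (cong (_∸ h) (swap k h a)) (m+n∸m≡n h (k + a)))) (Cut⇒∈ p)

∈⇒Cut : ∀ {f} k {m x} → x ∈ partXors f k m → ∃[ a ] m ≡ k + a × Cut f k a x
∈⇒Cut zero {zero} (here refl) = 0 , refl , []
∈⇒Cut {f} (suc k) {m} x∈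
  with h , h∈ , x∈′ ← find (∈-concatMap⁻ (λ h → map (λ y → f (suc h) ⊕ y) (partXors f k (m ∸ suc h))) x∈)
  with y , y∈ , refl ← ∈-map⁻ (λ y → f (suc h) ⊕ y) x∈′
  with a , eq , p ← ∈⇒Cut k y∈
  = h + a , total , h ∷ p
  where
  swap : ∀ k h a → suc h + (k + a) ≡ suc k + (h + a)
  swap = solve-∀
  total : m ≡ suc k + (h + a)
  total = trans (sym (m+[n∸m]≡n (∈-upTo⁻ h∈))) (trans (cong (suc h +_) eq) (swap k h a))

Cut-cong : ∀ {f g B k a x} → (∀ {h} → h < B → f (suc h) ≡ g (suc h)) → a < B →
  Cut f k a x → Cut g k a x
Cut-cong f≗g a<B [] = []
Cut-cong {f} {g} f≗g a<B (_∷_ {k} {a} {x} h p) =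
  subst (λ y → Cut g (suc k) (h + a) (y ⊕ x)) (sym (f≗g (≤-<-trans (m≤m+n h a) a<B)))
    (h ∷ Cut-cong f≗g (≤-<-trans (m≤n+m a h) a<B) p)

Cut-0s : ∀ {f} k → f 1 ≡ 0 → Cut f k 0 0
Cut-0s zero _ = []
Cut-0s {f} (suc k) f1 = subst (λ y → Cut f (suc k) 0 (y ⊕ 0)) f1 (0 ∷ Cut-0s k f1)

-- The mex recursion for the cut-set {1, `M`}, for a pile of size `suc N`. Lowering every size by
-- one turns the totals of the parts into `N ≡ suc a` and `N ≡ M + a`.
record Solves (M : ℕ) (F : ℕ → ℕ) : Set where
  field
    avoids₂ : ∀ {N a} → N ≡ suc a → ¬ Cut F 2 a (F (suc N))
    avoids₊ : ∀ {N a} → N ≡ M + a → ¬ Cut F (suc M) a (F (suc N))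
    reaches : ∀ {N v} → v < F (suc N) →
      (∃[ a ] N ≡ suc a × Cut F 2 a v) ⊎ (∃[ a ] N ≡ M + a × Cut F (suc M) a v)

module _ {M F} (1≤M : 1 ≤ M) (solves : Solves M F) where
  open Solves solves

  private
    C : List ℕ
    C = 1 ∷ M ∷ []

    <M+ : ∀ {N a} → N ≡ M + a → a < N
    <M+ {a = a} refl = +-monoˡ-≤ a 1≤M

  mex-options : ∀ {f} N → (∀ {h} → h < N → f (suc h) ≡ F (suc h)) → mex (options C f (suc N)) ≡ F (suc N)
  mex-options {f} N f≗F = mex-unique (options C f (suc N)) avoid reach
    where
    F≗f : ∀ {h} → h < N → F (suc h) ≡ f (suc h)
    F≗f h< = sym (f≗F h<)
    avoid : F (suc N) ∉ options C f (suc N)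
    avoid v∈ with ∈-concatMap⁻ (λ d → partXors f (suc d) (suc N)) {xs = C} v∈
    ... | here v∈₂ with a , eq , p ← ∈⇒Cut {f} 2 v∈₂ =
      avoids₂ (suc-injective eq) (Cut-cong {f} {F} f≗F (≤-reflexive (sym (suc-injective eq))) p)
    ... | there (here v∈₊) with a , eq , p ← ∈⇒Cut {f} (suc M) v∈₊ =
      avoids₊ (suc-injective eq) (Cut-cong {f} {F} f≗F (<M+ (suc-injective eq)) p)
    reach : ∀ {v} → v < F (suc N) → v ∈ options C f (suc N)
    reach v< with reaches v<
    ... | inj₁ (a , refl , p) =
      ∈-concatMap⁺ (λ d → partXors f (suc d) (suc N)) {xs = C} (here (Cut⇒∈ {f} (Cut-cong {F} {f} F≗f ≤-refl p)))
    ... | inj₂ (a , refl , p) =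
      ∈-concatMap⁺ (λ d → partXors f (suc d) (suc N)) {xs = C} (there (here (Cut⇒∈ {f} (Cut-cong {F} {f} F≗f (<M+ refl) p))))

  nimUpTo≗F : ∀ n {h} → suc h < n → nimUpTo C n (suc h) ≡ F (suc h)
  nimUpTo≗F (suc n) {h} (s≤s h<n) with suc h <ᵇ n in eq
  ... | true = nimUpTo≗F n (<ᵇ⇒< (suc h) n (subst T (sym eq) _))
  -- Here `n` is exactly `suc h`, the stage at which this value is first computed as a mex.
  ... | false with refl ← ≤-antisym h<n (≮⇒≥ λ lt → subst T eq (<⇒<ᵇ lt)) =
    mex-options h λ h′< → nimUpTo≗F n (s≤s h′<)

  𝒢≗F : ∀ N → 𝒢 C (suc N) ≡ F (suc N)
  𝒢≗F N = nimUpTo≗F (suc (suc N)) ≤-refl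

-- One period of the nim-values

-- For a < 12c written as 2c s + j, the pile of size suc a has nim-value g s j.
g : ℕ → ℕ → ℕ
g 0 j = j % 2
g 1 j = 2 + j % 2
g 2 zero = 1
g 2 j@(suc _) = 5 ∸ j % 2
g 3 j = 3 ∸ j % 2
g 4 j = 4 + j % 2
g _ j = 6 + j % 2

-- g s j and g s (pred j) only depend on the representative κ j < 4, so claims about all j can be decided.
κ : ℕ → ℕ
κ (suc (suc (suc (suc j)))) = κ (suc (suc j))
κ j = j

-- The least total of the s over parts written as 2c s + j whose values have XOR 2 h or 2 h + 1,
-- where e is the parity of that XOR plus the total of the j.
w : ℕ → ℕ → ℕ
w 0 0 = 0
w 0 1 = 1
w 0 2 = 4
w 0 _ = 5
w _ 0 = 2
w _ 1 = 3
w _ 2 = 2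
w _ _ = 3

-- Here `t` is the XOR modulo 8 and `p` the parity of the total of the j, which gives the arguments
-- e and h of `w`.
w₈ : ℕ → ℕ → ℕ
w₈ p t = w ((p + t) % 2) (t / 2)

-- (σ , δ , τ) encodes the parts suc (2c σ + δ) and suc (2c τ), which attain the minimum w e h = σ + τ;
-- a nonzero τ is needed only for e = 1, h = 3.
rep : ℕ → ℕ → ℕ × ℕ × ℕ
rep 0 0 = 0 , 0 , 0
rep 0 1 = 1 , 0 , 0
rep 0 2 = 4 , 0 , 0
rep 0 _ = 5 , 0 , 0
rep _ 0 = 2 , 0 , 0
rep _ 1 = 3 , 0 , 0
rep _ 2 = 2 , 1 , 0
rep _ _ = 2 , 1 , 1

rep₈ : ℕ → ℕ → ℕ × ℕ × ℕ
rep₈ p t = rep ((p + t) % 2) (t / 2)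

-- The total of the two parts has the parity of `δ`, so in a pile of parity `p` the rest supplies
-- the bit `(p + δ) % 2`. In the sum `σ + τ + δ` the remainder `δ` is charged as a whole `M`; the
-- bound 5 keeps the sum within one cycle of six.
Good : ℕ → ℕ → ℕ × ℕ × ℕ → Set
Good p t (σ , δ , τ) = (σ < 6 × δ < 2 × τ < 6) × (σ + τ + δ ≤ 5 × g σ δ ⊕ (g τ 0 ⊕ ((p + δ) % 2)) ≡ t)

Good? : ∀ p t r → Dec (Good p t r)
Good? p t (σ , δ , τ) = ((σ <? 6) ×-dec (δ <? 2) ×-dec (τ <? 6)) ×-dec
  ((σ + τ + δ ≤? 5) ×-dec (g σ δ ⊕ (g τ 0 ⊕ ((p + δ) % 2)) ≟ t))

cost : ℕ × ℕ × ℕ → ℕ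
cost (σ , δ , τ) = σ + τ + δ

-- Finite checks by exhaustive decision

abstract
  g-κ<8 : ∀ {s} → s < 6 → ∀ {k} → k < 4 → g s k < 8
  g-κ<8 = from-yes (allUpTo? (λ s → allUpTo? (λ k → g s k <? 8) 4) 6)

  ⊕<8 : ∀ {t} → t < 8 → ∀ {u} → u < 8 → t ⊕ u < 8
  ⊕<8 = from-yes (allUpTo? (λ t → allUpTo? (λ u → t ⊕ u <? 8) 8) 8)

  -- Joining two collections of parts adds their totals and XORs their values, so a minimum over
  -- collections is subadditive.
  w₈-subadditive : ∀ {p} → p < 2 → ∀ {r} → r < 2 → ∀ {t} → t < 8 → ∀ {u} → u < 8 →
    w₈ ((p + r) % 2) (t ⊕ u) ≤ w₈ p t + w₈ r u
  w₈-subadditive = from-yes (allUpTo? (λ p → allUpTo? (λ r → allUpTo? (λ t → allUpTo? (λ u →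
    w₈ ((p + r) % 2) (t ⊕ u) ≤? w₈ p t + w₈ r u) 8) 8) 2) 2)

  w₈-g : ∀ {s} → s < 6 → ∀ {k} → k < 4 → w₈ (k % 2) (g s k) ≡ s
  w₈-g = from-yes (allUpTo? (λ s → allUpTo? (λ k → w₈ (k % 2) (g s k) ≟ s) 4) 6)

  -- The remainders satisfy k = 1 + i + j here; on representatives only the parity of this and
  -- `k ≢ 0` survive. The latter excludes `g 1 0 ⊕ g 1 1 ≡ g 2 0`.
  no-carry : ∀ {r} → r < 6 → ∀ {s} → s < 6 → r + s < 6 →
    ∀ {i} → i < 4 → ∀ {j} → j < 4 → ∀ {k} → k < 4 →
    (1 + i + j) % 2 ≡ k % 2 → k ≢ 0 → g r i ⊕ g s j ≢ g (r + s) k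
  no-carry = from-yes (allUpTo? (λ r → allUpTo? (λ s → (r + s <? 6) →-dec
    allUpTo? (λ i → allUpTo? (λ j → allUpTo? (λ k →
      ((1 + i + j) % 2 ≟ k % 2) →-dec (¬? (k ≟ 0) →-dec ¬? (g r i ⊕ g s j ≟ g (r + s) k))) 4) 4) 4) 6) 6)

  -- The remainders overflow once, so k = 1 + i + j - `M`, which may be 0; the parity is unchanged
  -- because `M` is even.
  carry : ∀ {r} → r < 6 → ∀ {s} → s < 6 → suc (r + s) < 6 →
    ∀ {i} → i < 4 → ∀ {j} → j < 4 → ∀ {k} → k < 4 →
    (1 + i + j) % 2 ≡ k % 2 → g r i ⊕ g s j ≢ g (suc (r + s)) k
  carry = from-yes (allUpTo? (λ r → allUpTo? (λ s → (suc (r + s) <? 6) →-dec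
    allUpTo? (λ i → allUpTo? (λ j → allUpTo? (λ k →
      ((1 + i + j) % 2 ≟ k % 2) →-dec ¬? (g r i ⊕ g s j ≟ g (suc (r + s)) k)) 4) 4) 4) 6) 6)

  rep₈-good : ∀ {p} → p < 2 → ∀ {t} → t < 8 → Good p t (rep₈ p t)
  rep₈-good = from-yes (allUpTo? (λ p → allUpTo? (λ t → Good? p t (rep₈ p t)) 8) 2)

  -- With a = 2c s + j, the last three cases are the cuts into suc (a - 1) and suc 0,
  -- suc (2c - 1) and suc (2c (s - 1) + j), and suc 2c and suc (2c + j - 1).
  two-parts : ∀ {s} → s < 6 → ∀ {k} → k < 4 → ∀ {t} → t < 8 → t < g s k →
    cost (rep₈ (k % 2) t) < s
    ⊎ (0 < k × g s (pred k) ≡ t)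
    ⊎ (0 < s × 1 ⊕ g (pred s) k ≡ t)
    ⊎ (0 < k × s ≡ 2 × 2 ⊕ g 1 (pred k) ≡ t)
  two-parts = from-yes (allUpTo? (λ s → allUpTo? (λ k → allUpTo? (λ t → (t <? g s k) →-dec
    ((cost (rep₈ (k % 2) t) <? s)
    ⊎-dec (((0 <? k) ×-dec (g s (pred k) ≟ t))
    ⊎-dec (((0 <? s) ×-dec (1 ⊕ g (pred s) k ≟ t))
    ⊎-dec ((0 <? k) ×-dec (s ≟ 2) ×-dec (2 ⊕ g 1 (pred k) ≟ t)))))) 8) 4) 6)

-- Reduction to four representatives

κ<4 : ∀ j → κ j < 4
κ<4 0 = s≤s z≤n
κ<4 1 = s≤s (s≤s z≤n)
κ<4 2 = s≤s (s≤s (s≤s z≤n))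
κ<4 3 = ≤-refl
κ<4 (suc (suc (suc (suc j)))) = κ<4 (suc (suc j))

κ-parity : ∀ j → κ j % 2 ≡ j % 2
κ-parity 0 = refl
κ-parity 1 = refl
κ-parity 2 = refl
κ-parity 3 = refl
κ-parity (suc (suc (suc (suc j)))) = κ-parity (suc (suc j))

κ-zero : ∀ j → (κ j ≡ᵇ 0) ≡ (j ≡ᵇ 0)
κ-zero 0 = refl
κ-zero 1 = refl
κ-zero 2 = refl
κ-zero 3 = refl
κ-zero (suc (suc (suc (suc j)))) = κ-zero (suc (suc j))

pred-κ-parity : ∀ j → pred (κ j) % 2 ≡ pred j % 2
pred-κ-parity 0 = refl
pred-κ-parity 1 = refl
pred-κ-parity 2 = refl
pred-κ-parity 3 = refl
pred-κ-parity (suc (suc (suc (suc j)))) = pred-κ-parity (suc (suc j))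

-- Serves the reduction to `κ` and, at the end, the passage from the modulus `2 * c` to 6.
g-cong : ∀ s {i j} → (i ≡ᵇ 0) ≡ (j ≡ᵇ 0) → i % 2 ≡ j % 2 → g s i ≡ g s j
g-cong 0 _ p = p
g-cong 1 _ p = cong (2 +_) p
g-cong 2 {zero} {zero} _ p = refl
g-cong 2 {suc i} {suc j} _ p = cong (5 ∸_) p
g-cong 3 _ p = cong (3 ∸_) p
g-cong 4 _ p = cong (4 +_) p
g-cong (suc (suc (suc (suc (suc s))))) _ p = cong (6 +_) p

g-κ : ∀ s j → g s (κ j) ≡ g s j
g-κ s j = g-cong s (κ-zero j) (κ-parity j)

pred-κ-zero : ∀ j → (pred (κ j) ≡ᵇ 0) ≡ (pred j ≡ᵇ 0)
pred-κ-zero 0 = refl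
pred-κ-zero 1 = refl
pred-κ-zero 2 = refl
pred-κ-zero 3 = refl
pred-κ-zero 4 = refl
pred-κ-zero (suc (suc (suc (suc (suc j))))) = pred-κ-zero (suc (suc (suc j)))

g-pred-κ : ∀ s j → g s (pred (κ j)) ≡ g s (pred j)
g-pred-κ s j = g-cong s (pred-κ-zero j) (pred-κ-parity j)

-- Parity and division with remainder

+-parity : ∀ {i i′ j j′} → i % 2 ≡ i′ % 2 → j % 2 ≡ j′ % 2 → (i + j) % 2 ≡ (i′ + j′) % 2
+-parity {i} {i′} {j} {j′} p q = trans (%-distribˡ-+ i j 2)
  (trans (cong₂ (λ x y → (x + y) % 2) p q) (sym (%-distribˡ-+ i′ j′ 2)))

-- If A < B, the right side is already too large, whatever `t` is. No bound on `t` is assumed: it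
-- will be a sum of digits, and `s ≡ t` then shows that the sum does not overflow.
*+-squeeze : ∀ {n A B s t} → A ≤ B → s < n → n * A + s ≡ n * B + t → A ≡ B × s ≡ t
*+-squeeze {n} {A} {B} {s} {t} A≤B s<n eq with m≤n⇒m<n∨m≡n A≤B
... | inj₂ refl = refl , +-cancelˡ-≡ (n * A) s t eq
... | inj₁ A<B = contradiction eq (<⇒≢ (begin-strict
  n * A + s   <⟨ +-monoʳ-< (n * A) s<n ⟩
  n * A + n   ≡⟨ trans (+-comm (n * A) n) (sym (*-suc n A)) ⟩
  n * suc A   ≤⟨ *-monoʳ-≤ n A<B ⟩
  n * B       ≤⟨ m≤m+n (n * B) t ⟩
  n * B + t   ∎))
  where open ≤-Reasoning

*+-lex : ∀ {n A B s t} → t < n → n * A + s < n * B + t → A < B ⊎ (A ≡ B × s < t)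
*+-lex {n} {A} {B} {s} {t} t<n lt with <-cmp A B
... | tri< A<B _ _ = inj₁ A<B
... | tri≈ _ refl _ = inj₂ (refl , +-cancelˡ-< (n * A) s t lt)
... | tri> _ _ B<A = contradiction lt (<⇒≯ (begin-strict
  n * B + t   <⟨ +-monoʳ-< (n * B) t<n ⟩
  n * B + n   ≡⟨ trans (+-comm (n * B) n) (sym (*-suc n B)) ⟩
  n * suc B   ≤⟨ *-monoʳ-≤ n B<A ⟩
  n * A       ≤⟨ m≤m+n (n * A) s ⟩
  n * A + s   ∎))
  where open ≤-Reasoning

mod-unique : ∀ {n q r} .{{_ : NonZero n}} → r < n → (n * q + r) % n ≡ r
mod-unique {n} {q} {r} r<n = trans (%-remove-+ˡ r (m∣m*n q)) (m<n⇒m%n≡m r<n)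

div-unique : ∀ {n q r} .{{_ : NonZero n}} → r < n → (n * q + r) / n ≡ q
div-unique {n} {q} {r} r<n = trans (+-distrib-/-∣ˡ r (m∣m*n q))
  (trans (cong₂ _+_ (trans (cong (_/ n) (*-comm n q)) (m*n/n≡m q n)) (m<n⇒m/n≡0 r<n)) (+-identityʳ q))

divmod : ∀ m n .{{_ : NonZero n}} → m ≡ n * (m / n) + m % n
divmod m n = trans (m≡m%n+[m/n]*n m n)
  (trans (+-comm (m % n) _) (cong (_+ m % n) (*-comm (m / n) n)))

*+-injective : ∀ {n q q′ r r′} .{{_ : NonZero n}} → r < n → r′ < n → n * q + r ≡ n * q′ + r′ →
  q ≡ q′ × r ≡ r′
*+-injective {n} r< r′< eq =
  trans (sym (div-unique r<)) (trans (cong (_/ n) eq) (div-unique r′<)) ,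
  trans (sym (mod-unique r<)) (trans (cong (_% n) eq) (mod-unique r′<))

-- The weight and its subadditivity

-- p is the total of the a over the parts suc a; only its parity matters.
weight : ℕ → ℕ → ℕ
weight p v = 6 * (v / 8) + w₈ (p % 2) (v % 8)

weight-eval : ∀ p A {t} → t < 8 → weight p (8 * A + t) ≡ 6 * A + w₈ (p % 2) t
weight-eval p A t<8 = cong₂ (λ x y → 6 * x + w₈ (p % 2) y) (div-unique {8} {A} t<8) (mod-unique {8} {A} t<8)

-- XOR acts separately on `/ 8` and `% 8`: the high parts are bounded by `⊕≤+`, the low ones by the
-- finite check.
weight-subadditive : ∀ p r u v → weight (p + r) (u ⊕ v) ≤ weight p u + weight r v
weight-subadditive p r u v = begin
  weight (p + r) (u ⊕ v)
    ≡⟨ cong (weight (p + r)) (trans (cong₂ _⊕_ (divmod u 8) (divmod v 8)) (⊕-digits 3 (u / 8) (v / 8) (m%n<n u 8) (m%n<n v 8))) ⟩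
  weight (p + r) (8 * (u / 8 ⊕ v / 8) + (u % 8 ⊕ v % 8))
    ≡⟨ weight-eval (p + r) (u / 8 ⊕ v / 8) (⊕<8 (m%n<n u 8) (m%n<n v 8)) ⟩
  6 * (u / 8 ⊕ v / 8) + w₈ ((p + r) % 2) (u % 8 ⊕ v % 8)
    ≤⟨ +-mono-≤ (*-monoʳ-≤ 6 (⊕≤+ (u / 8) (v / 8))) (≤-trans
         (≤-reflexive (cong (λ z → w₈ z (u % 8 ⊕ v % 8)) (%-distribˡ-+ p r 2)))
         (w₈-subadditive (m%n<n p 2) (m%n<n r 2) (m%n<n u 8) (m%n<n v 8))) ⟩
  6 * (u / 8 + v / 8) + (w₈ (p % 2) (u % 8) + w₈ (r % 2) (v % 8))
    ≡⟨ lem (u / 8) (v / 8) (w₈ (p % 2) (u % 8)) (w₈ (r % 2) (v % 8)) ⟩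
  weight p u + weight r v ∎
  where
  open ≤-Reasoning
  lem : ∀ a b x y → 6 * (a + b) + (x + y) ≡ (6 * a + x) + (6 * b + y)
  lem = solve-∀

-- The closed form, and cuts into `suc M` parts

module Closed (M : ℕ) .{{_ : NonZero M}} (2∣M : 2 ∣ M) (6≤M : 6 ≤ M) where

  Q S J : ℕ → ℕ
  Q a = a / M / 6
  S a = a / M % 6
  J a = a % M

  F : ℕ → ℕ
  F h = 8 * Q (pred h) + g (S (pred h)) (J (pred h))

  J<M : ∀ a → J a < M
  J<M a = m%n<n a M

  S<6 : ∀ a → S a < 6
  S<6 a = m%n<n (a / M) 6

  J-parity : ∀ a → J a % 2 ≡ a % 2
  J-parity a = m∣n⇒o%n%m≡o%m 2 M a 2∣M

  M*-parity : ∀ q j → (M * q + j) % 2 ≡ j % 2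
  M*-parity q j = %-remove-+ˡ j (∣m⇒∣m*n q 2∣M)

  F-eval : ∀ A {s j} → s < 6 → j < M → F (suc (M * (6 * A + s) + j)) ≡ 8 * A + g s j
  F-eval A {s} {j} s<6 j<M
    rewrite div-unique {q = 6 * A + s} j<M | mod-unique {q = 6 * A + s} j<M
          | div-unique {q = A} s<6 | mod-unique {q = A} s<6 = refl

  g<8 : ∀ {s} → s < 6 → ∀ j → g s j < 8
  g<8 {s} s<6 j = subst (_< 8) (g-κ s j) (g-κ<8 s<6 (κ<4 j))

  -- By `w₈-g` a single part attains the minimum for its own value, and `a` has the parity of its
  -- remainder because `M` is even.
  weight-F : ∀ a → weight a (F (suc a)) ≡ a / M
  weight-F a = begin
    weight a (F (suc a))                         ≡⟨ weight-eval a (Q a) (g<8 (S<6 a) (J a)) ⟩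
    6 * Q a + w₈ (a % 2) (g (S a) (J a))         ≡⟨ cong₂ (λ p v → 6 * Q a + w₈ p v) same-parity (sym (g-κ (S a) (J a))) ⟩
    6 * Q a + w₈ (κ (J a) % 2) (g (S a) (κ (J a))) ≡⟨ cong (6 * Q a +_) (w₈-g (S<6 a) (κ<4 (J a))) ⟩
    6 * Q a + S a                                ≡⟨ sym (divmod (a / M) 6) ⟩
    a / M ∎
    where
    open ≡-Reasoning
    same-parity : a % 2 ≡ κ (J a) % 2
    same-parity = sym (trans (κ-parity (J a)) (J-parity a))

  -- By subadditivity each part `suc h` adds at most `h / M` to the weight, and `M * (h / M) ≤ h`.
  weight-Cut : ∀ {k a x} → Cut F k a x → M * weight a x ≤ a
  weight-Cut [] = ≤-reflexive (*-zeroʳ M)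
  weight-Cut (_∷_ {a = a} {x} h p) = begin
    M * weight (h + a) (F (suc h) ⊕ x)             ≤⟨ *-monoʳ-≤ M (weight-subadditive h a (F (suc h)) x) ⟩
    M * (weight h (F (suc h)) + weight a x)        ≡⟨ *-distribˡ-+ M _ (weight a x) ⟩
    M * weight h (F (suc h)) + M * weight a x      ≡⟨ cong (λ z → M * z + M * weight a x) (weight-F h) ⟩
    M * (h / M) + M * weight a x                   ≤⟨ +-mono-≤ (≤-trans (m≤m+n _ (h % M)) (≤-reflexive (sym (divmod h M)))) (weight-Cut p) ⟩
    h + a ∎
    where open ≤-Reasoning

  -- The value would have weight `suc (a / M)`, but parts of total `a` allow only weight `a / M`.
  F∉Cut₊ : ∀ {N a} → N ≡ M + a → ¬ Cut F (suc M) a (F (suc N))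
  F∉Cut₊ {a = a} refl p = <-irrefl refl (begin-strict
    a                                ≡⟨ divmod a M ⟩
    M * (a / M) + a % M              <⟨ +-monoʳ-< _ (J<M a) ⟩
    M * (a / M) + M                  ≡⟨ +-comm _ M ⟩
    M + M * (a / M)                  ≡⟨ sym (*-suc M (a / M)) ⟩
    M * suc (a / M)                  ≡⟨ cong (M *_) (sym heavier) ⟩
    M * weight a (F (suc (M + a)))   ≤⟨ weight-Cut p ⟩
    a ∎)
    where
    open ≤-Reasoning
    heavier : weight a (F (suc (M + a))) ≡ suc (a / M)
    heavier = trans
      -- The weight sees only the parity of its first argument, so the even `M` may be added to `a`.
      (cong (λ z → 6 * (F (suc (M + a)) / 8) + w₈ z (F (suc (M + a)) % 8)) (sym (%-remove-+ˡ a 2∣M)))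
      (trans (weight-F (M + a)) (trans (+-distrib-/-∣ˡ a ∣-refl) (cong (_+ a / M) (n/n≡1 M))))

  -- Cuts into two parts miss the value

  suc-+-divmod : ∀ a₀ a₁ → suc (a₀ + a₁) ≡ M * (a₀ / M + a₁ / M) + suc (J a₀ + J a₁)
  suc-+-divmod a₀ a₁ = trans (cong₂ (λ x y → suc (x + y)) (divmod a₀ M) (divmod a₁ M))
    (lem M (a₀ / M) (a₁ / M) (J a₀) (J a₁))
    where
    lem : ∀ m x y i j → suc ((m * x + i) + (m * y + j)) ≡ m * (x + y) + suc (i + j)
    lem = solve-∀

  -- Either `suc (J a₀ + J a₁)` is below `M` and is itself the remainder, hence nonzero, or it
  -- overflows exactly once.
  quotient-+ : ∀ a₀ a₁ → let N = suc (a₀ + a₁) in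
    (N / M ≡ a₀ / M + a₁ / M × J N ≢ 0) ⊎ N / M ≡ suc (a₀ / M + a₁ / M)
  quotient-+ a₀ a₁ with suc (J a₀ + J a₁) <? M
  ... | yes j<M = inj₁ (trans (cong (_/ M) (suc-+-divmod a₀ a₁)) (div-unique j<M) ,
          λ J≡0 → contradiction
            (trans (sym J≡0) (trans (cong (_% M) (suc-+-divmod a₀ a₁)) (mod-unique j<M))) λ ())
  ... | no j≮M = inj₂ (trans (cong (_/ M) split) (div-unique j′<M))
    where
    j′ : ℕ
    j′ = suc (J a₀ + J a₁) ∸ M
    M+j′ : M + j′ ≡ suc (J a₀ + J a₁)
    M+j′ = m+[n∸m]≡n (≮⇒≥ j≮M)
    j′<M : j′ < M
    j′<M = +-cancelˡ-< M j′ M (subst (_< M + M) (sym M+j′) (+-mono-≤-< (J<M a₀) (J<M a₁)))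
    lem : ∀ m x j → m * x + (m + j) ≡ m * suc x + j
    lem = solve-∀
    split : suc (a₀ + a₁) ≡ M * suc (a₀ / M + a₁ / M) + j′
    split = trans (suc-+-divmod a₀ a₁)
      (trans (cong (M * (a₀ / M + a₁ / M) +_) (sym M+j′)) (lem M (a₀ / M + a₁ / M) j′))

  -- Equality would hold separately for the high parts and the low digits. The high parts give
  -- `Q N ≤ Q a₀ + Q a₁`, which by `*+-squeeze` forbids an overflow among the `S`; the low digits
  -- then contradict `no-carry` or `carry`.
  F⊕F≢F : ∀ a₀ a₁ → F (suc a₀) ⊕ F (suc a₁) ≢ F (suc (suc (a₀ + a₁)))
  F⊕F≢F a₀ a₁ eq = go (quotient-+ a₀ a₁)
    where
    N i j k : ℕ
    N = suc (a₀ + a₁)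
    i = κ (J a₀)
    j = κ (J a₁)
    k = κ (J N)
    g₀<8 : g (S a₀) (J a₀) < 8
    g₀<8 = g<8 (S<6 a₀) (J a₀)
    g₁<8 : g (S a₁) (J a₁) < 8
    g₁<8 = g<8 (S<6 a₁) (J a₁)
    digits : (Q a₀ ⊕ Q a₁ ≡ Q N) × (g (S a₀) (J a₀) ⊕ g (S a₁) (J a₁) ≡ g (S N) (J N))
    digits = *+-injective {8} (⊕<8 g₀<8 g₁<8) (g<8 (S<6 N) (J N))
      (trans (sym (⊕-digits 3 (Q a₀) (Q a₁) g₀<8 g₁<8)) eq)
    κ-digits : g (S a₀) i ⊕ g (S a₁) j ≡ g (S N) k
    κ-digits = trans (cong₂ _⊕_ (g-κ (S a₀) (J a₀)) (g-κ (S a₁) (J a₁)))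
      (trans (proj₂ digits) (sym (g-κ (S N) (J N))))
    parities : (1 + i + j) % 2 ≡ k % 2
    parities = trans (+-parity {1 + i} {1 + a₀} {j} {a₁} (+-parity {1} {1} {i} {a₀} refl (trans (κ-parity (J a₀)) (J-parity a₀)))
        (trans (κ-parity (J a₁)) (J-parity a₁)))
      (sym (trans (κ-parity (J N)) (J-parity N)))
    Q≤ : Q N ≤ Q a₀ + Q a₁
    Q≤ = subst (_≤ Q a₀ + Q a₁) (proj₁ digits) (⊕≤+ (Q a₀) (Q a₁))
    S≡ : ∀ e → N / M ≡ e + (a₀ / M + a₁ / M) → S N ≡ e + (S a₀ + S a₁)
    S≡ e q≡ = proj₂ (*+-squeeze {6} Q≤ (S<6 N) (trans (sym (divmod (N / M) 6)) (trans q≡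
      (trans (cong₂ (λ x y → e + (x + y)) (divmod (a₀ / M) 6) (divmod (a₁ / M) 6))
        (lem e (Q a₀) (Q a₁) (S a₀) (S a₁))))))
      where
      lem : ∀ e x y s t → e + ((6 * x + s) + (6 * y + t)) ≡ 6 * (x + y) + (e + (s + t))
      lem = solve-∀
    go : ¬ ((N / M ≡ a₀ / M + a₁ / M × J N ≢ 0) ⊎ N / M ≡ suc (a₀ / M + a₁ / M))
    go (inj₁ (q≡ , J≢0)) = no-carry (S<6 a₀) (S<6 a₁) (subst (_< 6) (S≡ 0 q≡) (S<6 N))
      (κ<4 (J a₀)) (κ<4 (J a₁)) (κ<4 (J N)) parities
      (λ k≡0 → J≢0 (≡ᵇ⇒≡ (J N) 0 (subst T (trans (cong (_≡ᵇ 0) (sym k≡0)) (κ-zero (J N))) _)))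
      (trans κ-digits (cong (λ s → g s k) (S≡ 0 q≡)))
    go (inj₂ q≡) = carry (S<6 a₀) (S<6 a₁) (subst (_< 6) (S≡ 1 q≡) (S<6 N))
      (κ<4 (J a₀)) (κ<4 (J a₁)) (κ<4 (J N)) parities
      (trans κ-digits (cong (λ s → g s k) (S≡ 1 q≡)))

  F∉Cut₂ : ∀ {N a} → N ≡ suc a → ¬ Cut F 2 a (F (suc N))
  F∉Cut₂ refl p = cut₂ p refl refl
    where
    cut₂ : ∀ {a b x} → Cut F 2 a x → a ≡ b → x ≢ F (suc (suc b))
    cut₂ (h₀ ∷ h₁ ∷ []) refl eq = F⊕F≢F h₀ h₁ (trans (cong (F (suc h₀) ⊕_) (sym (⊕-identityʳ _)))
      (trans eq (cong (λ z → F (suc (suc (h₀ + z)))) (+-identityʳ h₁))))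

  -- Reaching all smaller values

  F⊕F-eval : ∀ A {s r i j} → s < 6 → r < 6 → i < M → j < M →
    F (suc (M * (6 * A + s) + i)) ⊕ F (suc (M * (6 * 0 + r) + j)) ≡ 8 * A + (g s i ⊕ g r j)
  F⊕F-eval A {s} {r} {i} {j} s<6 r<6 i<M j<M = begin
    F (suc (M * (6 * A + s) + i)) ⊕ F (suc (M * (6 * 0 + r) + j))
      ≡⟨ cong₂ _⊕_ (F-eval A s<6 i<M) (F-eval 0 r<6 j<M) ⟩
    (8 * A + g s i) ⊕ (8 * 0 + g r j)
      ≡⟨ ⊕-digits 3 A 0 (g<8 s<6 i) (g<8 r<6 j) ⟩
    8 * (A ⊕ 0) + (g s i ⊕ g r j)
      ≡⟨ cong (λ z → 8 * z + (g s i ⊕ g r j)) (⊕-identityʳ A) ⟩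
    8 * A + (g s i ⊕ g r j) ∎
    where open ≡-Reasoning

  F-low : ∀ {x} → x < M → F (suc x) ≡ x % 2
  F-low {x} x<M = trans (cong (λ z → F (suc (z + x))) (sym (*-zeroʳ M))) (F-eval 0 (s≤s z≤n) x<M)

  Reach₂ Reach₊ : ℕ → ℕ → Set
  Reach₂ N v = ∃[ a ] N ≡ suc a × Cut F 2 a v
  Reach₊ N v = ∃[ a ] N ≡ M + a × Cut F (suc M) a v

  reach₂ : ∀ {N v} a₀ a₁ → N ≡ suc (a₀ + a₁) → F (suc a₀) ⊕ F (suc a₁) ≡ v → Reach₂ N v
  reach₂ a₀ a₁ refl refl = a₀ + a₁ , refl ,
    subst₂ (Cut F 2) (cong (a₀ +_) (+-identityʳ a₁)) (cong (F (suc a₀) ⊕_) (⊕-identityʳ _)) (a₀ ∷ a₁ ∷ [])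

  -- The remaining total R is used up by a part R % 2, two equal parts R / 2, whose values cancel, and parts 0.
  reach₊ : ∀ {N v} a₀ a₁ → M + (a₀ + a₁) ≤ N →
    F (suc a₀) ⊕ (F (suc a₁) ⊕ ((N + (a₀ + a₁)) % 2)) ≡ v → Reach₊ N v
  reach₊ {N} {v} a₀ a₁ ≤N v≡ = rest , total ,
    subst (λ k → Cut F k rest v) (cong suc (m+[n∸m]≡n 4≤M)) (subst (Cut F _ _) value
      -- Five explicit parts and `M ∸ 4` parts of size 1, whose value is 0, make `suc M` parts.
      (a₀ ∷ a₁ ∷ R % 2 ∷ R / 2 ∷ R / 2 ∷ Cut-0s (M ∸ 4) (F-low (≤-trans (s≤s z≤n) 6≤M))))
    where
    open ≡-Reasoning
    4≤M : 4 ≤ M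
    4≤M = ≤-trans (m≤n+m 4 2) 6≤M
    R : ℕ
    R = N ∸ (M + (a₀ + a₁))
    lem : ∀ m a b x y → (m + (a + b)) + (x + 2 * y) ≡ m + (a + (b + (x + (y + (y + 0)))))
    lem = solve-∀
    rest : ℕ
    rest = a₀ + (a₁ + (R % 2 + (R / 2 + (R / 2 + 0))))
    total : N ≡ M + rest
    total = trans (sym (m+[n∸m]≡n ≤N)) (trans (cong (M + (a₀ + a₁) +_) (sym (halves R)))
      (lem M a₀ a₁ (R % 2) (R / 2)))
    lem′ : ∀ m a r → (m + a + r) + a ≡ m + (r + a * 2)
    lem′ = solve-∀
    -- Modulo 2 the subtraction in `R` becomes an addition and the even `M` drops out.
    R-parity : R % 2 ≡ (N + (a₀ + a₁)) % 2
    R-parity = sym (begin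
      (N + (a₀ + a₁)) % 2                        ≡⟨ cong (λ n → (n + (a₀ + a₁)) % 2) (sym (m+[n∸m]≡n ≤N)) ⟩
      (M + (a₀ + a₁) + R + (a₀ + a₁)) % 2        ≡⟨ cong (_% 2) (lem′ M (a₀ + a₁) R) ⟩
      (M + (R + (a₀ + a₁) * 2)) % 2              ≡⟨ %-remove-+ˡ (R + (a₀ + a₁) * 2) 2∣M ⟩
      (R + (a₀ + a₁) * 2) % 2                    ≡⟨ [m+kn]%n≡m%n R (a₀ + a₁) 2 ⟩
      R % 2 ∎)
    b : ℕ
    b = F (suc (R / 2))
    last : F (suc (R % 2)) ⊕ (b ⊕ (b ⊕ 0)) ≡ (N + (a₀ + a₁)) % 2
    last = begin
      F (suc (R % 2)) ⊕ (b ⊕ (b ⊕ 0))   ≡⟨ cong (λ z → F (suc (R % 2)) ⊕ (b ⊕ z)) (⊕-identityʳ b) ⟩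
      F (suc (R % 2)) ⊕ (b ⊕ b)         ≡⟨ cong (F (suc (R % 2)) ⊕_) (⊕-self b) ⟩
      F (suc (R % 2)) ⊕ 0               ≡⟨ ⊕-identityʳ _ ⟩
      F (suc (R % 2))                   ≡⟨ F-low (<-≤-trans (m%n<n R 2) (≤-trans (m≤n+m 2 4) 6≤M)) ⟩
      R % 2 % 2                         ≡⟨ m%n%n≡m%n R 2 ⟩
      R % 2                             ≡⟨ R-parity ⟩
      (N + (a₀ + a₁)) % 2 ∎
    value : F (suc a₀) ⊕ (F (suc a₁) ⊕ (F (suc (R % 2)) ⊕ (b ⊕ (b ⊕ 0)))) ≡ v
    value = trans (cong (λ z → F (suc a₀) ⊕ (F (suc a₁) ⊕ z)) last) v≡

  <2⇒<M : ∀ {i} → i < 2 → i < M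
  <2⇒<M i<2 = <-≤-trans i<2 (≤-trans (m≤n+m 2 4) 6≤M)

  -- The two parts take at most `M * (6 * A + cost r)`; the extra `suc` leaves room for the `M` lost
  -- in making `suc M` parts.
  reach-rep : ∀ {N} A {t r} → Good (N % 2) t r → suc (6 * A + cost r) ≤ N / M → Reach₊ N (8 * A + t)
  reach-rep {N} A {t} {σ , δ , τ} ((σ<6 , δ<2 , τ<6) , _ , g≡t) heavy = reach₊ a₀ a₁ fits value
    where
    a₀ a₁ : ℕ
    a₀ = M * (6 * A + σ) + δ
    a₁ = M * (6 * 0 + τ) + 0
    fits : M + (a₀ + a₁) ≤ N
    fits = begin
      M + ((M * (6 * A + σ) + δ) + (M * τ + 0))     ≤⟨ +-monoʳ-≤ M (+-monoˡ-≤ (M * τ + 0) (+-monoʳ-≤ (M * (6 * A + σ)) (m≤n*m δ M))) ⟩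
      M + ((M * (6 * A + σ) + M * δ) + (M * τ + 0)) ≡⟨ lem M A σ δ τ ⟩
      M * suc (6 * A + (σ + τ + δ))                 ≤⟨ *-monoʳ-≤ M heavy ⟩
      M * (N / M)                                   ≤⟨ m≤m+n _ (N % M) ⟩
      M * (N / M) + N % M                           ≡⟨ sym (divmod N M) ⟩
      N ∎
      where
      open ≤-Reasoning
      lem : ∀ m A σ δ τ → m + ((m * (6 * A + σ) + m * δ) + (m * τ + 0)) ≡ m * suc (6 * A + (σ + τ + δ))
      lem = solve-∀
    e : ℕ
    e = (N % 2 + δ) % 2
    same-parity : (N + (a₀ + a₁)) % 2 ≡ e
    same-parity = +-parity {N} {N % 2} {a₀ + a₁} {δ} (sym (m%n%n≡m%n N 2))
      (trans (+-parity {a₀} {δ} {a₁} {0} (M*-parity (6 * A + σ) δ) (M*-parity (6 * 0 + τ) 0))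
        (cong (_% 2) (+-identityʳ δ)))
    e<8 : e < 8
    e<8 = <-≤-trans (m%n<n (N % 2 + δ) 2) (m≤n+m 2 6)
    value : F (suc a₀) ⊕ (F (suc a₁) ⊕ ((N + (a₀ + a₁)) % 2)) ≡ 8 * A + t
    value = begin
      F (suc a₀) ⊕ (F (suc a₁) ⊕ ((N + (a₀ + a₁)) % 2))
        ≡⟨ cong₂ _⊕_ (F-eval A σ<6 (<2⇒<M δ<2)) (cong₂ _⊕_ (F-eval 0 τ<6 (<2⇒<M (s≤s z≤n))) same-parity) ⟩
      (8 * A + g σ δ) ⊕ (g τ 0 ⊕ e)
        ≡⟨ ⊕-digits 3 A 0 (g<8 σ<6 δ) (⊕<8 (g<8 τ<6 0) e<8) ⟩
      8 * (A ⊕ 0) + (g σ δ ⊕ (g τ 0 ⊕ e))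
        ≡⟨ cong₂ (λ x y → 8 * x + y) (⊕-identityʳ A) g≡t ⟩
      8 * A + t ∎
      where open ≡-Reasoning

  -- If `A < Q N`, every `t` fits because each cost is at most 5. If `A ≡ Q N`, then `t` is below
  -- the low digit of the pile and `two-parts` lists the ways to reach it.
  F-reaches-digits : ∀ N A {t} → t < 8 → 8 * A + t < F (suc N) → Reach₂ N (8 * A + t) ⊎ Reach₊ N (8 * A + t)
  F-reaches-digits N A {t} t<8 v<F with *+-lex {8} {A} {Q N} (g<8 (S<6 N) (J N)) v<F
  ... | inj₁ A<Q = inj₂ (reach-rep A good (begin
    suc (6 * A + cost (rep₈ (N % 2) t)) ≤⟨ s≤s (+-monoʳ-≤ (6 * A) (proj₁ (proj₂ good))) ⟩
    suc (6 * A + 5)                     ≡⟨ lem A ⟩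
    6 * suc A                           ≤⟨ *-monoʳ-≤ 6 A<Q ⟩
    6 * Q N                             ≤⟨ m≤m+n (6 * Q N) (S N) ⟩
    6 * Q N + S N                       ≡⟨ sym (divmod (N / M) 6) ⟩
    N / M ∎))
    where
    open ≤-Reasoning
    good : Good (N % 2) t (rep₈ (N % 2) t)
    good = rep₈-good (m%n<n N 2) t<8
    lem : ∀ A → suc (6 * A + 5) ≡ 6 * suc A
    lem = solve-∀
  ... | inj₂ (refl , t<g) = go (two-parts (S<6 N) (κ<4 (J N)) t<8 (subst (t <_) (sym (g-κ (S N) (J N))) t<g))
    where
    s j : ℕ
    s = S N
    j = J N
    good : Good (N % 2) t (rep₈ (N % 2) t)
    good = rep₈-good (m%n<n N 2) t<8
    split : N ≡ M * (6 * A + s) + j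
    split = trans (divmod N M) (cong (λ q → M * q + j) (divmod (N / M) 6))
    0<j : 0 < κ j → j ≡ suc (pred j)
    0<j 0<κ with j
    ... | suc j′ = refl
    pred-j<M : pred j < M
    pred-j<M = ≤-<-trans (pred[n]≤n {j}) (J<M N)
    M≡ : M ≡ suc (pred M)
    M≡ = sym (suc-pred M)
    go : cost (rep₈ (κ j % 2) t) < s
         ⊎ (0 < κ j × g s (pred (κ j)) ≡ t)
         ⊎ (0 < s × 1 ⊕ g (pred s) (κ j) ≡ t)
         ⊎ (0 < κ j × s ≡ 2 × 2 ⊕ g 1 (pred (κ j)) ≡ t) →
         Reach₂ N (8 * A + t) ⊎ Reach₊ N (8 * A + t)
    go (inj₁ cost<s) = inj₂ (reach-rep A good (begin
      suc (6 * A + cost (rep₈ (N % 2) t)) ≡⟨ sym (+-suc (6 * A) _) ⟩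
      6 * A + suc (cost (rep₈ (N % 2) t)) ≡⟨ cong (λ p → 6 * A + suc (cost (rep₈ p t))) (sym (trans (κ-parity j) (J-parity N))) ⟩
      6 * A + suc (cost (rep₈ (κ j % 2) t)) ≤⟨ +-monoʳ-≤ (6 * A) cost<s ⟩
      6 * A + s                           ≡⟨ sym (divmod (N / M) 6) ⟩
      N / M ∎))
      where open ≤-Reasoning
    go (inj₂ (inj₁ (0<κ , g≡t))) = inj₁ (reach₂ (M * (6 * A + s) + pred j) (M * (6 * 0 + 0) + 0)
      (trans split (trans (cong (M * (6 * A + s) +_) (0<j 0<κ)) (lem M (M * (6 * A + s)) (pred j))))
      (trans (F⊕F-eval A (S<6 N) (s≤s z≤n) pred-j<M (<2⇒<M (s≤s z≤n)))
        (cong (8 * A +_) (trans (⊕-identityʳ (g s (pred j))) (trans (sym (g-pred-κ s j)) g≡t)))))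
      where
      lem : ∀ m x i → x + suc i ≡ suc ((x + i) + (m * 0 + 0))
      lem = solve-∀
    go (inj₂ (inj₂ (inj₁ (0<s , g≡t)))) = inj₁ (reach₂ (M * (6 * A + 0) + pred M) (M * (6 * 0 + pred s) + j)
      (trans split (trans (cong (λ s → M * (6 * A + s) + j) (sym (suc-pred s {{>-nonZero 0<s}})))
        (trans (lem M A (pred s) j) (trans (cong (λ m → M * (6 * A) + M * pred s + m + j) M≡)
          (lem′ M A (pred s) j (pred M))))))
      (trans (F⊕F-eval A (s≤s z≤n) (≤-<-trans (pred[n]≤n {s}) (S<6 N)) pred-M<M (J<M N))
        (cong (8 * A +_) (trans (cong₂ _⊕_ odd (sym (g-κ (pred s) j))) g≡t))))
      where
      lem : ∀ m A s j → m * (6 * A + suc s) + j ≡ m * (6 * A) + m * s + m + j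
      lem = solve-∀
      lem′ : ∀ m A s j p → m * (6 * A) + m * s + suc p + j ≡ suc ((m * (6 * A + 0) + p) + (m * s + j))
      lem′ = solve-∀
      pred-M<M : pred M < M
      pred-M<M = subst (pred M <_) (sym M≡) ≤-refl
      -- This parity is the low digit `g 0 (pred M)`, the source of `1 ⊕` in `two-parts`.
      odd : pred M % 2 ≡ 1
      odd = %-pred-≡0 {pred M} {2} (subst (λ m → m % 2 ≡ 0) M≡ (n∣m⇒m%n≡0 M 2 2∣M))
    go (inj₂ (inj₂ (inj₂ (0<κ , s≡2 , g≡t)))) = inj₁ (reach₂ (M * (6 * A + 1) + 0) (M * (6 * 0 + 1) + pred j)
      (trans split (trans (cong₂ (λ s j → M * (6 * A + s) + j) s≡2 (0<j 0<κ)) (lem M A (pred j))))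
      (trans (F⊕F-eval A (s≤s (s≤s z≤n)) (s≤s (s≤s z≤n)) (<2⇒<M (s≤s z≤n)) pred-j<M)
        (cong (8 * A +_) (trans (cong (2 ⊕_) (sym (g-pred-κ 1 j))) g≡t))))
      where
      lem : ∀ m A i → m * (6 * A + 2) + suc i ≡ suc ((m * (6 * A + 1) + 0) + (m * 1 + i))
      lem = solve-∀

  F-solves : Solves M F
  F-solves = record
    { avoids₂ = F∉Cut₂
    ; avoids₊ = F∉Cut₊
    ; reaches = λ {N} {v} v<F → subst (λ v → Reach₂ N v ⊎ Reach₊ N v) (sym (divmod v 8))
        (F-reaches-digits N (v / 8) (m%n<n v 8) (subst (_< F (suc N)) (divmod v 8) v<F))
    }

-- Comparison of `2 * c` with 6 through `φ`

≡ᵇ-true : ∀ m n → (m ≡ᵇ n) ≡ true → m ≡ n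
≡ᵇ-true m n e = ≡ᵇ⇒≡ m n (subst T (sym e) _)

[2*n∸1]%2≡1 : ∀ n .{{_ : NonZero n}} → (2 * n ∸ 1) % 2 ≡ 1
[2*n∸1]%2≡1 (suc n) = %-pred-≡0 {2 * suc n ∸ 1} {2} (n∣m⇒m%n≡0 (2 * suc n) 2 (m∣m*n (suc n)))

suc-%2-cancel : ∀ i j → suc i % 2 ≡ suc j % 2 → i % 2 ≡ j % 2
suc-%2-cancel i j eq = +-parity {1} {1} {suc i} {suc j} refl eq

-- Whether it is zero and its parity are all that `g s` sees of its second argument, so `ρ` can
-- stand in for `j` as a remainder modulo 6.
rPrime-spec : ∀ c j → 3 ≤ c → ∃[ ρ ] rPrime c (suc j) ≡ suc ρ × ρ < 6 × (ρ ≡ᵇ 0) ≡ (j ≡ᵇ 0) × ρ % 2 ≡ j % 2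
rPrime-spec c zero _ = 0 , refl , s≤s z≤n , refl , refl
rPrime-spec c 1 _ = 1 , refl , s≤s (s≤s z≤n) , refl , refl
rPrime-spec c j@(suc (suc i)) 3≤c with suc j ≡ᵇ (2 * c ∸ 1) in e₅
... | true = 4 , refl , n≤1+n 5 , refl ,
  sym (suc-%2-cancel j 4 (trans (cong (_% 2) (≡ᵇ-true (suc j) (2 * c ∸ 1) e₅)) ([2*n∸1]%2≡1 c {{>-nonZero (≤-trans (s≤s z≤n) 3≤c)}})))
... | false with suc j ≡ᵇ (2 * c) in e₆
...   | true = 5 , refl , ≤-refl , refl ,
  sym (suc-%2-cancel j 5 (trans (cong (_% 2) (≡ᵇ-true (suc j) (2 * c) e₆)) (n∣m⇒m%n≡0 (2 * c) 2 (m∣m*n c))))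
...   | false with suc j % 2 in e | m%n<n (suc j) 2
...     | 0 | _ = 3 , refl , s≤s (s≤s (s≤s (s≤s z≤n))) , refl , sym (suc-%2-cancel j 3 e)
...     | 1 | _ = 2 , refl , s≤s (s≤s (s≤s z≤n)) , refl , sym (suc-%2-cancel j 2 e)
...     | suc (suc _) | s≤s (s≤s ())

-- Both sides have the closed form with the same quotient `q`; only the remainders `j` and `ρ`
-- differ, and `g-cong` identifies their values.
𝒢-φ : ∀ c .{{_ : NonZero c}} → 3 ≤ c → ∀ N → 𝒢 (1 ∷ (2 * c) ∷ []) (suc N) ≡ 𝒢 (1 ∷ 6 ∷ []) (φ c 1 (suc N))
𝒢-φ c 3≤c N = proof (rPrime-spec c (N % (2 * c)) 3≤c)
  where
  instance
    2c≢0 : NonZero (2 * c)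
    2c≢0 = m*n≢0 2 c
  q j : ℕ
  q = N / (2 * c)
  j = N % (2 * c)
  module Fc = Closed (2 * c) (m∣m*n c) (*-monoʳ-≤ 2 3≤c)
  module F₃ = Closed 6 (m∣m*n 3) ≤-refl
  proof : (∃[ ρ ] rPrime c (suc j) ≡ suc ρ × ρ < 6 × (ρ ≡ᵇ 0) ≡ (j ≡ᵇ 0) × ρ % 2 ≡ j % 2) →
    𝒢 (1 ∷ (2 * c) ∷ []) (suc N) ≡ 𝒢 (1 ∷ 6 ∷ []) (φ c 1 (suc N))
  proof (ρ , r′≡ , ρ<6 , zero≡ , parity≡) = begin
    𝒢 (1 ∷ (2 * c) ∷ []) (suc N)
      ≡⟨ 𝒢≗F (≤-trans (s≤s z≤n) (*-monoʳ-≤ 2 3≤c)) Fc.F-solves N ⟩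
    8 * (q / 6) + g (q % 6) j
      ≡⟨ cong (8 * (q / 6) +_) (g-cong (q % 6) (sym zero≡) (sym parity≡)) ⟩
    8 * (q / 6) + g (q % 6) ρ
      ≡⟨ sym (F₃.F-eval (q / 6) (m%n<n q 6) ρ<6) ⟩
    F₃.F (suc (6 * (6 * (q / 6) + q % 6) + ρ))
      ≡⟨ cong (λ q → F₃.F (suc (6 * q + ρ))) (sym (divmod q 6)) ⟩
    F₃.F (suc (6 * q + ρ))
      ≡⟨ sym (𝒢≗F (s≤s z≤n) F₃.F-solves (6 * q + ρ)) ⟩
    𝒢 (1 ∷ 6 ∷ []) (suc (6 * q + ρ))
      ≡⟨ cong (𝒢 (1 ∷ 6 ∷ [])) (sym φ≡) ⟩
    𝒢 (1 ∷ 6 ∷ []) (φ c 1 (suc N)) ∎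
    where
    open ≡-Reasoning
    φ≡ : φ c 1 (suc N) ≡ suc (6 * q + ρ)
    φ≡ = trans (m+n∸n≡m (6 * q + rPrime c (suc j)) 1) (trans (cong (6 * q +_) r′≡) (+-suc (6 * q) ρ))

theorem2 : (c : ℕ) → (c≥3 : 3 ≤ c) → (n : ℕ) → 1 ≤ n →
    𝒢 (1 ∷ (2 * c) ∷ []) n
    ≡ 𝒢 (1 ∷ 6 ∷ []) (φ c {{>-nonZero (≤-trans (s≤s z≤n) c≥3)}} 1 n)
theorem2 c c≥3 (suc N) (s≤s _) = 𝒢-φ c {{>-nonZero (≤-trans (s≤s z≤n) c≥3)}} c≥3 N
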